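{- Let $G$ be a finite simple graph of order $n$ (that is, $|V(G)|=n$) without isolated vertices. Then for every positive integer $k\le n$, $$\beta_S^k(G)\ge n-k-\omega(G),$$ where $\omega(G)$ denotes the number of connected components of $G$.
   Context: For a finite simple graph $G$ and $v\in V(G)$, let $E_G(v)$ denote the set of all edges of $G$ incident with $v$. For a function $f:E(G)\to\{ -1,1\}$ and $S\subseteq E(G)$, write $f(S)=\sum_{e\in S}f(e)$ (so $f(\emptyset)=0$). A signed $k$-submatching of $G$ is a function $f:E(G)\to\{ -1,1\}$ such that $f(E_G(v))\leq 1$ holds for at least $k$ vertices $v\in V(G)$. The signed $k$-submatching number $\beta_S^k(G)$ is the maximum of $f(E(G))$ taken over all signed $k$-submatchings $f$ of $G$. -}

module Defs where

open import Data.Bool.Properties using () renaming (_≟_ to _≟ᵇ_)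
open import Data.Empty using (⊥-elim-irr)
open import Data.Fin.Base using (Fin; _<_)
open import Data.Fin.Properties using (_≟_; _<?_)
open import Data.Fin.Subset using (Subset)
open import Data.Integer.Base as ℤ using (ℤ; 0ℤ; 1ℤ; -1ℤ)
import Data.Integer.Properties as ℤₚ
open import Data.List.Base
  using (List; []; _∷_; _++_; map; filter; foldr; length; allFin; deduplicate;
         mapMaybe; cartesianProduct)
open import Data.List.Extrema ℤₚ.≤-totalOrder using (max; xs≤max; argmax-sel)
open import Data.List.Membership.Propositional using (_∈_; lose)
open import Data.List.Membership.Propositional.Properties
  using (∈-allFin; ∈-map⁺; ∈-map⁻; ∈-filter⁺; ∈-filter⁻; ∈-++⁺ˡ; ∈-++⁺ʳ;
         ∈-cartesianProduct⁺)
open import Data.List.Properties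
  using (filter-all; filter-accept; filter-reject; filter-≐; length-tabulate; map-cong)
import Data.List.Relation.Unary.All as All
open import Data.List.Relation.Unary.Any using (here; there)
import Data.List.Relation.Unary.Any as Any
import Data.List.Relation.Unary.Any.Properties as Anyₚ
open Anyₚ using (mapMaybe⁺)
open import Data.List.Relation.Unary.Unique.Propositional using (Unique)
import Data.List.Relation.Unary.Unique.Propositional.Properties as Uniqueₚ
open import Data.Maybe.Base using (Maybe; just; nothing)
import Data.Maybe.Relation.Unary.Any as MAny
open import Data.Nat.Base as ℕ using (ℕ)
import Data.Nat.Properties as ℕₚ
open import Data.Product.Base using (∃-syntax; _×_; _,_; proj₁; proj₂)
open import Data.Sign.Base using (Sign)
open import Data.Sum.Base using (_⊎_; inj₁; inj₂; [_,_]′)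
import Data.Vec.Base as Vec
open import Data.Vec.Properties using (≡-dec)
open import Function.Base using (id; const; _∘_)
open import Level using (0ℓ)
open import Relation.Binary.Construct.Closure.ReflexiveTransitive using (Star; ε; _◅_; _◅◅_)
open import Relation.Binary.Core using (Rel)
open import Relation.Binary.Definitions using (Decidable; Irreflexive; Symmetric; DecidableEquality)
open import Relation.Binary.PropositionalEquality
  using (_≡_; _≗_; refl; sym; trans; cong; subst)
open import Relation.Nullary.Decidable using (yes; no; does; map′; _×-dec_; _⊎-dec_)
import Relation.Unary as Unary
open import Relation.Nullary.Negation using (¬_; contradiction)

record Graph (n : ℕ) : Set₁ where
  field
    Adj     : Rel (Fin n) 0ℓ
    adj?    : Decidable Adj
    adjSym  : Symmetric Adj
    adjIrr  : Irreflexive _≡_ Adj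

module _ {n : ℕ} (G : Graph n) where
  open Graph G

  NoIsolatedVertices : Set
  NoIsolatedVertices = ∀ v → ∃[ u ] Adj v u

  -- An unordered pair of adjacent vertices, listed with the smaller one first.
  -- The proofs are irrelevant, so an edge is determined by its endpoints.
  record Edge : Set where
    constructor mkEdge
    field
      src tgt   : Fin n
      .ordered  : src < tgt
      .adjacent : Adj src tgt

  open Edge public

  _≟ᴱ_ : DecidableEquality Edge
  mkEdge u v _ _ ≟ᴱ mkEdge u′ v′ _ _ =
    map′ (λ { (refl , refl) → refl }) (λ { refl → refl , refl }) (u ≟ u′ ×-dec v ≟ v′)

  AdjacentInOrder : Fin n × Fin n → Set
  AdjacentInOrder (u , v) = u < v × Adj u v

  adjacentInOrder? : Unary.Decidable AdjacentInOrder
  adjacentInOrder? (u , v) = u <? v ×-dec adj? u v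

  edge? : Fin n × Fin n → Maybe Edge
  edge? (u , v) with adjacentInOrder? (u , v)
  ... | yes (u<v , uv) = just (mkEdge u v u<v uv)
  ... | no  _          = nothing

  -- Lists each edge exactly once: see ∈-edges and edges-unique.
  edges : List Edge
  edges = mapMaybe edge? (cartesianProduct (allFin n) (allFin n))

  Incident : Fin n → Edge → Set
  Incident v e = src e ≡ v ⊎ tgt e ≡ v

  incident? : Decidable Incident
  incident? v e = (src e ≟ v) ⊎-dec (tgt e ≟ v)

  edgesAt : Fin n → List Edge
  edgesAt v = filter (incident? v) edges

  Signing : Set
  Signing = Edge → Sign

  value : Sign → ℤ
  value Sign.+ = 1ℤ
  value Sign.- = -1ℤ

  sumOver : Signing → List Edge → ℤ
  sumOver f S = foldr ℤ._+_ 0ℤ (map (value ∘ f) S)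

  weight : Signing → ℤ
  weight f = sumOver f edges

  Good : Signing → Fin n → Set
  Good f v = sumOver f (edgesAt v) ℤ.≤ 1ℤ

  good? : Decidable Good
  good? f v = sumOver f (edgesAt v) ℤₚ.≤? 1ℤ

  IsSignedSubmatching : ℕ → Signing → Set
  IsSignedSubmatching k f = k ℕ.≤ length (filter (good? f) (allFin n))

  isSignedSubmatching? : Decidable IsSignedSubmatching
  isSignedSubmatching? k f = k ℕₚ.≤? length (filter (good? f) (allFin n))

  setPlus : Edge → Signing → Signing
  setPlus e f e′ with e ≟ᴱ e′
  ... | yes _ = Sign.+
  ... | no  _ = f e′

  allMinus : Signing
  allMinus = const Sign.-

  -- All signings that are -1 outside the given edges, up to pointwise equality.
  signingsOn : List Edge → List Signing
  signingsOn []       = allMinus ∷ []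
  signingsOn (e ∷ es) = signingsOn es ++ map (setPlus e) (signingsOn es)

  signedSubmatchings : ℕ → List Signing
  signedSubmatchings k = filter (isSignedSubmatching? k) (signingsOn edges)

  -- `max` needs a default value. For k ≤ n the signing allMinus is itself a
  -- signed k-submatching, so the default does not affect the result: see
  -- βS-attained and βS-upper.
  βS : ℕ → ℤ
  βS k = max (weight allMinus) (map weight (signedSubmatchings k))

  Connected : Rel (Fin n) 0ℓ
  Connected = Star Adj

  -- Connection by a walk all of whose interior vertices lie in the given list.
  Via : List (Fin n) → Rel (Fin n) 0ℓ
  Via []       u v = u ≡ v ⊎ Adj u v
  Via (w ∷ ws) u v = Via ws u v ⊎ (Via ws u w × Via ws w v)

  via? : ∀ ws → Decidable (Via ws)
  via? []       u v = (u ≟ v) ⊎-dec adj? u v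
  via? (w ∷ ws) u v = via? ws u v ⊎-dec (via? ws u w ×-dec via? ws w v)

  via⇒connected : ∀ ws {u v} → Via ws u v → Connected u v
  via⇒connected []       (inj₁ refl)    = ε
  via⇒connected []       (inj₂ uv)      = uv ◅ ε
  via⇒connected (w ∷ ws) (inj₁ p)       = via⇒connected ws p
  via⇒connected (w ∷ ws) (inj₂ (p , q)) = via⇒connected ws p ◅◅ via⇒connected ws q

  via-base : ∀ ws {u v} → u ≡ v ⊎ Adj u v → Via ws u v
  via-base []       p = p
  via-base (w ∷ ws) p = inj₁ (via-base ws p)

  via-trans : ∀ ws {u w v} → w ∈ ws → Via ws u w → Via ws w v → Via ws u v
  via-trans (x ∷ ws) (here refl) p q = inj₂ ([ id , proj₁ ]′ p , [ id , proj₂ ]′ q)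
  via-trans (x ∷ ws) (there w∈) (inj₁ p) (inj₁ q) = inj₁ (via-trans ws w∈ p q)
  via-trans (x ∷ ws) (there w∈) (inj₁ p) (inj₂ (a , b)) = inj₂ (via-trans ws w∈ p a , b)
  via-trans (x ∷ ws) (there w∈) (inj₂ (a , b)) (inj₁ q) = inj₂ (a , via-trans ws w∈ b q)
  via-trans (x ∷ ws) (there w∈) (inj₂ (a , _)) (inj₂ (_ , d)) = inj₂ (a , d)

  connected⇒via : ∀ {u v} → Connected u v → Via (allFin n) u v
  connected⇒via ε        = via-base (allFin n) (inj₁ refl)
  connected⇒via (uv ◅ p) =
    via-trans (allFin n) (∈-allFin _) (via-base (allFin n) (inj₂ uv)) (connected⇒via p)

  connected? : Decidable Connected
  connected? u v = map′ (via⇒connected (allFin n)) connected⇒via (via? (allFin n) u v)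

  component : Fin n → Subset n
  component v = Vec.tabulate (λ u → does (connected? v u))

  components : List (Subset n)
  components = deduplicate (≡-dec _≟ᵇ_) (map component (allFin n))

  ω : ℕ
  ω = length components

  edge?-complete : ∀ e → MAny.Any (e ≡_) (edge? (src e , tgt e))
  edge?-complete (mkEdge u v u<v uv) with adjacentInOrder? (u , v)
  ... | yes _ = MAny.just refl
  ... | no ¬p = ⊥-elim-irr (¬p (u<v , uv))

  ∈-edges : ∀ e → e ∈ edges
  ∈-edges e = mapMaybe⁺ edge? pairs (Anyₚ.map⁺ (lose e∈ (edge?-complete e)))
    where
    pairs = cartesianProduct (allFin n) (allFin n)
    e∈    = ∈-cartesianProduct⁺ (∈-allFin (src e)) (∈-allFin (tgt e))

  ends-mapMaybe : ∀ ps → map (λ e → src e , tgt e) (mapMaybe edge? ps)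
                ≡ filter adjacentInOrder? ps
  ends-mapMaybe [] = refl
  ends-mapMaybe (p ∷ ps) with adjacentInOrder? p
  ... | yes q = trans (cong (p ∷_) (ends-mapMaybe ps)) (sym (filter-accept adjacentInOrder? q))
  ... | no ¬q = trans (ends-mapMaybe ps) (sym (filter-reject adjacentInOrder? ¬q))

  edges-unique : Unique edges
  edges-unique = Uniqueₚ.map⁻ (subst Unique (sym (ends-mapMaybe pairs)) (Uniqueₚ.filter⁺ _
    (Uniqueₚ.cartesianProduct⁺ (Uniqueₚ.allFin⁺ n) (Uniqueₚ.allFin⁺ n))))
    where
    pairs = cartesianProduct (allFin n) (allFin n)

  sumOver-cong : ∀ {f g : Signing} → f ≗ g → ∀ S → sumOver f S ≡ sumOver g S
  sumOver-cong f≗g S = cong (foldr ℤ._+_ 0ℤ) (map-cong (cong value ∘ f≗g) S)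

  isSignedSubmatching-cong : ∀ {k} {f g : Signing} → f ≗ g →
                             IsSignedSubmatching k f → IsSignedSubmatching k g
  isSignedSubmatching-cong {k} {f} {g} f≗g = subst (λ vs → k ℕ.≤ length vs)
    (filter-≐ (good? f) (good? g)
      ( (λ {v} → subst (ℤ._≤ 1ℤ) (sumOver-cong f≗g (edgesAt v)))
      , (λ {v} → subst (ℤ._≤ 1ℤ) (sym (sumOver-cong f≗g (edgesAt v)))))
      (allFin n))

  signingsOn-complete : ∀ (f : Signing) es → ∃[ g ] g ∈ signingsOn es
                      × (∀ e → e ∈ es → g e ≡ f e) × (∀ e → ¬ e ∈ es → g e ≡ Sign.-)
  signingsOn-complete f [] = allMinus , here refl , (λ _ ()) , λ _ _ → refl
  signingsOn-complete f (x ∷ es)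
    with g , g∈ , on , off ← signingsOn-complete f es
    with f x in fx | Any.any? (x ≟ᴱ_) es
  ... | Sign.- | yes x∈ = g , ∈-++⁺ˡ g∈
    , (λ { _ (here refl) → on x x∈ ; e (there e∈) → on e e∈ })
    , λ e e∉ → off e (e∉ ∘ there)
  ... | Sign.- | no x∉ = g , ∈-++⁺ˡ g∈
    , (λ { _ (here refl) → trans (off x x∉) (sym fx) ; e (there e∈) → on e e∈ })
    , λ e e∉ → off e (e∉ ∘ there)
  ... | Sign.+ | _ = setPlus x g , ∈-++⁺ʳ (signingsOn es) (∈-map⁺ (setPlus x) g∈) , on′ , off′
    where
    on′ : ∀ e → e ∈ x ∷ es → setPlus x g e ≡ f e
    on′ e e∈ with x ≟ᴱ e | e∈
    ... | yes refl | _        = sym fx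
    ... | no x≢e  | here refl = contradiction refl x≢e
    ... | no _    | there e∈′ = on e e∈′
    off′ : ∀ e → ¬ e ∈ x ∷ es → setPlus x g e ≡ Sign.-
    off′ e e∉ with x ≟ᴱ e
    ... | yes refl = contradiction (here refl) e∉
    ... | no _     = off e (e∉ ∘ there)

  allMinus-≤0 : ∀ S → sumOver allMinus S ℤ.≤ 0ℤ
  allMinus-≤0 []      = ℤₚ.≤-refl
  allMinus-≤0 (_ ∷ S) = ℤₚ.+-mono-≤ ℤ.-≤+ (allMinus-≤0 S)

  allMinus-isSignedSubmatching : ∀ {k} → k ℕ.≤ n → IsSignedSubmatching k allMinus
  allMinus-isSignedSubmatching {k} k≤n = subst (k ℕ.≤_)
    (sym (trans (cong length (filter-all (good? allMinus) (All.universal good (allFin n))))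
                (length-tabulate id)))
    k≤n
    where
    good : ∀ v → Good allMinus v
    good v = ℤₚ.≤-trans (allMinus-≤0 (edgesAt v)) (ℤ.+≤+ ℕ.z≤n)

  βS-attained : ∀ {k} → k ℕ.≤ n → ∃[ f ] IsSignedSubmatching k f × weight f ≡ βS k
  βS-attained {k} k≤n
    with argmax-sel id (weight allMinus) (map weight (signedSubmatchings k))
  ... | inj₁ eq = allMinus , allMinus-isSignedSubmatching k≤n , sym eq
  ... | inj₂ m∈ with f , f∈ , eq ← ∈-map⁻ weight m∈ =
    f , proj₂ (∈-filter⁻ (isSignedSubmatching? k) {xs = signingsOn edges} f∈) , sym eq

  βS-upper : ∀ {k} (f : Signing) → IsSignedSubmatching k f → weight f ℤ.≤ βS k
  βS-upper {k} f sub with g , g∈ , on , _ ← signingsOn-complete f edges =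
    subst (ℤ._≤ βS k) (sumOver-cong g≗f edges)
      (All.lookup (xs≤max (weight allMinus) (map weight (signedSubmatchings k)))
        (∈-map⁺ weight (∈-filter⁺ (isSignedSubmatching? k) g∈
          (isSignedSubmatching-cong {k} (sym ∘ g≗f) sub))))
    where
    g≗f : g ≗ f
    g≗f e = on e (∈-edges e)

{-# OPTIONS --safe #-}
-- The lower bound is attained by induction on d = n − k: some signing f with at
-- most d vertices of degree sum above 1 has weight at least d − ω. Raising an edge
-- from −1 to 1 spoils at most two vertices and adds 2 to the weight, which leads
-- from d to d + 2; if every edge is already 1, the weight is |E| ≥ n − ω.
-- For d = 0, fix a root in each component and list the vertices so that every
-- other one has a later neighbour. Going through the list, pair up the edges at
-- the current vertex v and join each pair into one alternating trail, which
-- cancels their contributions at v. A closed trail of odd length at v can be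
-- absorbed by the edge to the later neighbour, so it survives at roots only, where
-- it is given the sum −2. The remaining open trails contribute at most 1 at each
-- vertex and, signed suitably, a nonnegative amount in total.
module Submission where

open import Data.Nat.Base as ℕ using (ℕ; zero; suc; z≤n; s≤s)
open import Data.Integer.Base as ℤ using (ℤ; +_; _-_; _≥_; 0ℤ; 1ℤ; -1ℤ; -_)
open import Defs

import Data.Integer.Properties as ℤₚ
import Data.Nat.Properties as ℕₚ
import Data.Sign.Properties as Signₚ
open import Algebra.Properties.CommutativeMonoid.Sum ℤₚ.+-0-commutativeMonoid
  using (sum; sum-cong-≗; ∑-distrib-+)
open import Data.Bool.Base using (Bool; true; false; if_then_else_)
open import Data.Empty using (⊥-elim-irr)
open import Data.Fin.Base as Fin using (Fin; zero; suc)
open import Data.Fin.Properties as Finₚ using (_≟_; <-cmp)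
open import Data.Integer.Tactic.RingSolver using (solve-∀)
open import Data.List.Base using (List; []; _∷_; [_]; _++_; map; length; allFin; filter)
import Data.List.Membership.DecPropositional as DecMembership
open import Data.List.Membership.Propositional using (_∈_; _∉_; find)
open import Data.List.Membership.Propositional.Properties
  using (∈-∃++; ∈-map⁺; ∈-map⁻; ∈-allFin; ∈-++⁺ˡ; ∈-++⁺ʳ; ∈-filter⁺; ∈-filter⁻;
         ∈-deduplicate⁺; ∈-length)
open import Data.List.Properties using (length-++; length-map; length-tabulate)
open import Data.List.Relation.Binary.Permutation.Propositional
  using (_↭_; refl; prep; swap; trans; ↭-sym; ↭-trans)
open import Data.List.Relation.Binary.Permutation.Propositional.Properties
  using (shift; ∈-resp-↭; ++⁺ˡ; ↭-length)
open import Data.List.Relation.Binary.Subset.Propositional using (_⊆_)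
open import Data.List.Relation.Unary.All as All using (All; []; _∷_)
import Data.List.Relation.Unary.All.Properties as Allₚ
open import Data.List.Relation.Unary.AllPairs using ([]; _∷_)
open import Data.List.Relation.Unary.Any as Any using (here; there)
open import Data.List.Relation.Unary.Unique.Propositional using (Unique)
open import Data.List.Relation.Unary.Unique.Propositional.Properties using (allFin⁺; filter⁺)
open import Data.Product.Base using (∃-syntax; _×_; _,_; proj₁; proj₂)
open import Data.Sign.Base as Sign using (Sign; opposite)
open import Data.Sum.Base using (_⊎_; inj₁; inj₂)
import Data.Vec.Base as Vec
open import Data.Vec.Properties using (lookup∘tabulate)
open import Function.Base using (_∘_; id)
open import Relation.Binary.Construct.Closure.ReflexiveTransitive using (ε; _◅_)
open import Relation.Binary.Definitions using (tri<; tri≈; tri>)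
open import Relation.Binary.PropositionalEquality as ≡
  using (_≡_; _≢_; refl; cong; cong₂; subst; module ≡-Reasoning)
open import Relation.Nullary.Decidable using (yes; no; does; dec-true)
open import Relation.Nullary.Negation using (¬_; contradiction)

private variable
  n : ℕ

-- Sums over the vertices and indicator functions

sum-nonneg : (f : Fin n → ℤ) → (∀ i → 0ℤ ℤ.≤ f i) → 0ℤ ℤ.≤ sum f
sum-nonneg {zero}  f 0≤f = ℤₚ.≤-refl
sum-nonneg {suc n} f 0≤f = ℤₚ.+-mono-≤ (0≤f zero) (sum-nonneg (f ∘ suc) (0≤f ∘ suc))

sum-zero : ∀ n → sum {n} (λ _ → 0ℤ) ≡ 0ℤ
sum-zero zero    = refl
sum-zero (suc n) = ≡.trans (ℤₚ.+-identityˡ _) (sum-zero n)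

δℕ : Fin n → Fin n → ℕ
δℕ u v = if does (u ≟ v) then 1 else 0

δ : Fin n → Fin n → ℤ
δ u v = + δℕ u v

δℕ-same : (v : Fin n) → δℕ v v ≡ 1
δℕ-same v with v ≟ v
... | yes _  = refl
... | no v≢v = contradiction refl v≢v

δℕ-other : {u v : Fin n} → u ≢ v → δℕ u v ≡ 0
δℕ-other {u = u} {v} u≢v with u ≟ v
... | yes u≡v = contradiction u≡v u≢v
... | no _    = refl

sum-δ : (u : Fin n) → sum (δ u) ≡ 1ℤ
sum-δ {suc n} zero    = cong (ℤ._+_ 1ℤ) (sum-zero n)
sum-δ {suc n} (suc u) = begin
  0ℤ ℤ.+ sum (δ (suc u) ∘ suc)  ≡⟨ ℤₚ.+-identityˡ _ ⟩
  sum (δ (suc u) ∘ suc)         ≡⟨ sum-cong-≗ (λ v → cong +_ (suc-δ u v)) ⟩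
  sum (δ u)                     ≡⟨ sum-δ u ⟩
  1ℤ                            ∎
  where
  open ≡-Reasoning
  suc-δ : ∀ (u v : Fin n) → δℕ (suc u) (suc v) ≡ δℕ u v
  suc-δ u v with u ≟ v
  ... | yes _ = refl
  ... | no _  = refl

-- Signed trails and moves on lists of trails

infixr 8 _·_

_·_ : Sign → ℤ → ℤ
Sign.+ · z = z
Sign.- · z = - z

-- An abstract trail from a to b. Alternating along its edges, it changes the
-- degree sums of its end vertices only: by s at a and by s τ at b, where τ is +
-- if the trail has odd length and − otherwise.
record Link (n : ℕ) : Set where
  constructor link
  field
    start end : Fin n
    parity    : Sign

effect : Link n → Fin n → ℤ
effect (link a b τ) v = δ a v ℤ.+ τ · δ b v

-- A choice of one sign per link whose signed effects add up to `x`. The equations are pointwise, so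
-- `x` matters only up to extensional equality.
data Attains {n} : List (Link n) → (Fin n → ℤ) → Set where
  []  : ∀ {x} → (∀ v → x v ≡ 0ℤ) → Attains [] x
  add : ∀ {e es x y} s → Attains es y →
        (∀ v → x v ≡ s · effect e v ℤ.+ y v) → Attains (e ∷ es) x

degree : Fin n → List (Link n) → ℕ
degree v []                  = 0
degree v (link a b _ ∷ es) = δℕ a v ℕ.+ δℕ b v ℕ.+ degree v es

-- Moves at `v` through which attainable sums pull back: what the new list attains, the old one
-- attains too. `merge` glues two trails so that they alternate through `v`; their lengths add,
-- which gives the parity `opposite (σ * τ)`. `cancel` drops a closed trail of even length, whose
-- two contributions at `v` cancel.
data Reduction (v : Fin n) : List (Link n) → List (Link n) → Set where
  permute : ∀ {es es′} → es ↭ es′ → Reduction v es es′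
  under   : ∀ {es es′} e → Reduction v es es′ → Reduction v (e ∷ es) (e ∷ es′)
  _then_  : ∀ {es es′ es″} → Reduction v es es′ → Reduction v es′ es″ → Reduction v es es″
  reverse : ∀ {a τ es} → Reduction v (link a v τ ∷ es) (link v a τ ∷ es)
  merge   : ∀ {a b σ τ es} → Reduction v (link v a σ ∷ link v b τ ∷ es)
                                         (link a b (opposite (σ Sign.* τ)) ∷ es)
  cancel  : ∀ {es} → Reduction v (link v v Sign.- ∷ es) es

infixl 5 _then_

attains-↭ : ∀ {es es′ : List (Link n)} {x} → es ↭ es′ → Attains es′ x → Attains es x
attains-↭ refl         p             = p
attains-↭ (prep e q)   (add s p x≡)  = add s (attains-↭ q p) x≡
attains-↭ (trans q q′) p             = attains-↭ q (attains-↭ q′ p)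
attains-↭ (swap e e′ q) (add {x = x} s′ (add {y = z} s p y≡) x≡) =
  add s (add s′ (attains-↭ q p) (λ _ → refl)) λ v → begin
    x v                                                  ≡⟨ x≡ v ⟩
    s′ · effect e′ v ℤ.+ _                               ≡⟨ cong (ℤ._+_ (s′ · effect e′ v)) (y≡ v) ⟩
    s′ · effect e′ v ℤ.+ (s · effect e v ℤ.+ z v)        ≡⟨ exchange (s′ · effect e′ v) (s · effect e v) (z v) ⟩
    s · effect e v ℤ.+ (s′ · effect e′ v ℤ.+ z v)        ∎
  where
  open ≡-Reasoning
  exchange : ∀ i j k → i ℤ.+ (j ℤ.+ k) ≡ j ℤ.+ (i ℤ.+ k)
  exchange = solve-∀

·-distribˡ-+ : ∀ s i j → s · (i ℤ.+ j) ≡ s · i ℤ.+ s · j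
·-distribˡ-+ Sign.+ i j = refl
·-distribˡ-+ Sign.- i j = ℤₚ.neg-distrib-+ i j

·-assoc : ∀ s t i → (s Sign.* t) · i ≡ s · t · i
·-assoc Sign.+ t      i = refl
·-assoc Sign.- Sign.+ i = refl
·-assoc Sign.- Sign.- i = ≡.sym (ℤₚ.neg-involutive i)

opposite-· : ∀ s i → opposite s · i ≡ - (s · i)
opposite-· Sign.+ i = refl
opposite-· Sign.- i = ≡.sym (ℤₚ.neg-involutive i)

·-neg : ∀ s i → s · (- i) ≡ - (s · i)
·-neg Sign.+ i = refl
·-neg Sign.- i = refl

·-involutive : ∀ s i → s · s · i ≡ i
·-involutive Sign.+ i = refl
·-involutive Sign.- i = ℤₚ.neg-involutive i

reverse-effect : ∀ s τ i j → s · (i ℤ.+ τ · j) ≡ (s Sign.* τ) · (j ℤ.+ τ · i)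
reverse-effect s τ i j
  rewrite ·-assoc s τ (j ℤ.+ τ · i) | ·-distribˡ-+ τ j (τ · i) | ·-involutive τ i =
  cong (s ·_) (ℤₚ.+-comm i (τ · j))

-- The two trails start at `v` with opposite signs, so `k` drops out. The first sign is `s * σ`
-- because its far end then receives `s`, as the merged trail requires.
merge-effect : ∀ s σ τ i j k y →
  s · (i ℤ.+ opposite (σ Sign.* τ) · j) ℤ.+ y ≡
  (s Sign.* σ) · (k ℤ.+ σ · i) ℤ.+ (opposite (s Sign.* σ) · (k ℤ.+ τ · j) ℤ.+ y)
merge-effect s σ τ i j k y
  rewrite opposite-· (s Sign.* σ) (k ℤ.+ τ · j)
        | ·-assoc s σ (k ℤ.+ σ · i) | ·-assoc s σ (k ℤ.+ τ · j)
        | ·-distribˡ-+ σ k (σ · i) | ·-involutive σ i | ·-distribˡ-+ σ k (τ · j)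
        | opposite-· (σ Sign.* τ) j | ·-assoc σ τ j
        | ·-distribˡ-+ s (σ · k) i | ·-distribˡ-+ s (σ · k) (σ · τ · j)
        | ·-distribˡ-+ s i (- (σ · τ · j)) | ·-neg s (σ · τ · j) =
  identity (s · i) (s · σ · τ · j) (s · σ · k) y
  where
  identity : ∀ a b c d → a ℤ.+ - b ℤ.+ d ≡ c ℤ.+ a ℤ.+ (- (c ℤ.+ b) ℤ.+ d)
  identity = solve-∀

cancel-effect : ∀ i y → y ≡ (i ℤ.+ - i) ℤ.+ y
cancel-effect = solve-∀

attains-reduction : ∀ {v : Fin n} {es es′ x} → Reduction v es es′ → Attains es′ x → Attains es x
attains-reduction (permute q) p            = attains-↭ q p
attains-reduction (under e r) (add s p x≡) = add s (attains-reduction r p) x≡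
attains-reduction (r then r′) p            = attains-reduction r (attains-reduction r′ p)
attains-reduction {v = v} (reverse {a} {τ}) (add {y = y} s p x≡) =
  add (s Sign.* τ) p λ u → ≡.trans (x≡ u)
    (cong (ℤ._+ y u) (reverse-effect s τ (δ v u) (δ a u)))
attains-reduction {v = v} (merge {a} {b} {σ} {τ}) (add {y = y} s p x≡) =
  add (s Sign.* σ) (add (opposite (s Sign.* σ)) p (λ _ → refl)) λ u → ≡.trans (x≡ u)
    (merge-effect s σ τ (δ a u) (δ b u) (δ v u) (y u))
attains-reduction {v = v} {x = x} cancel p =
  add Sign.+ p λ u → cancel-effect (δ v u) (x u)

degree-↭ : ∀ (u : Fin n) {es es′} → es ↭ es′ → degree u es ≡ degree u es′
degree-↭ u refl                 = refl
degree-↭ u (prep (link a b _) q) = cong (δℕ a u ℕ.+ δℕ b u ℕ.+_) (degree-↭ u q)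
degree-↭ u (trans q q′)         = ≡.trans (degree-↭ u q) (degree-↭ u q′)
degree-↭ u {es′ = _ ∷ _ ∷ es′} (swap (link a b _) (link c d _) q) =
  ≡.trans (cong (λ k → i ℕ.+ (j ℕ.+ k)) (degree-↭ u q)) (begin
    i ℕ.+ (j ℕ.+ k)  ≡⟨ ℕₚ.+-assoc i j k ⟨
    i ℕ.+ j ℕ.+ k    ≡⟨ cong (ℕ._+ k) (ℕₚ.+-comm i j) ⟩
    j ℕ.+ i ℕ.+ k    ≡⟨ ℕₚ.+-assoc j i k ⟩
    j ℕ.+ (i ℕ.+ k)  ∎)
  where
  open ≡-Reasoning
  i = δℕ a u ℕ.+ δℕ b u
  j = δℕ c u ℕ.+ δℕ d u
  k = degree u es′

-- No move creates a link end: `merge` and `cancel` each remove two ends at `v`, the others keep all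
-- ends. Hence vertices treated earlier stay of small degree.
degree-reduction : ∀ {v : Fin n} {es es′} u → Reduction v es es′ → degree u es′ ℕ.≤ degree u es
degree-reduction u (permute q)            = ℕₚ.≤-reflexive (≡.sym (degree-↭ u q))
degree-reduction u (under (link a b _) r) = ℕₚ.+-monoʳ-≤ (δℕ a u ℕ.+ δℕ b u) (degree-reduction u r)
degree-reduction u (r then r′)            = ℕₚ.≤-trans (degree-reduction u r′) (degree-reduction u r)
degree-reduction {v = v} {es = _ ∷ es} u (reverse {a}) =
  ℕₚ.≤-reflexive (cong (ℕ._+ degree u es) (ℕₚ.+-comm (δℕ v u) (δℕ a u)))
degree-reduction {v = v} {es = _ ∷ _ ∷ es} u (merge {a} {b}) =
  ℕₚ.≤-trans (ℕₚ.≤-reflexive (ℕₚ.+-assoc (δℕ a u) (δℕ b u) _))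
    (ℕₚ.+-mono-≤ (ℕₚ.m≤n+m (δℕ a u) (δℕ v u))
                 (ℕₚ.+-monoˡ-≤ (degree u es) (ℕₚ.m≤n+m (δℕ b u) (δℕ v u))))
degree-reduction {es = _ ∷ es} u cancel = ℕₚ.m≤n+m (degree u es) _

-- Apart from reordering, moves rewrite only links that end at `v`. This keeps the edges among the
-- vertices still to be treated.
∈-reduction : ∀ {v a b : Fin n} {τ es es′} → a ≢ v → b ≢ v → Reduction v es es′ →
              link a b τ ∈ es → link a b τ ∈ es′
∈-reduction a≢v b≢v (permute q) e∈          = ∈-resp-↭ q e∈
∈-reduction a≢v b≢v (under e r) (here e≡)   = here e≡
∈-reduction a≢v b≢v (under e r) (there e∈)  = there (∈-reduction a≢v b≢v r e∈)
∈-reduction a≢v b≢v (r then r′) e∈          = ∈-reduction a≢v b≢v r′ (∈-reduction a≢v b≢v r e∈)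
∈-reduction a≢v b≢v reverse (here refl)     = contradiction refl b≢v
∈-reduction a≢v b≢v reverse (there e∈)      = there e∈
∈-reduction a≢v b≢v merge (here refl)       = contradiction refl a≢v
∈-reduction a≢v b≢v merge (there (here refl)) = contradiction refl a≢v
∈-reduction a≢v b≢v merge (there (there e∈)) = there e∈
∈-reduction a≢v b≢v cancel (here refl)      = contradiction refl a≢v
∈-reduction a≢v b≢v cancel (there e∈)       = e∈

-- Pairing up the trails at one vertex

module _ (v : Fin n) where

  half : Fin n × Sign → Link n
  half (w , τ) = link v w τ

  oddLoops : Bool → List (Link n)
  oddLoops false = []
  oddLoops true  = [ link v v Sign.+ ]

  -- A normal form of `es` at `v`: links from `v` to other vertices, links missing `v`, and at most
  -- one odd loop. One Boolean suffices for the loops, since even loops cancel and two odd loops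
  -- merge into an even one.
  record Split (es : List (Link n)) : Set where
    field
      odd         : Bool
      halves      : List (Fin n × Sign)
      rest        : List (Link n)
      halves≢     : All (λ h → proj₁ h ≢ v) halves
      rest-degree : degree v rest ≡ 0
      reduction   : Reduction v es (oddLoops odd ++ map half halves ++ rest)

  open Split

  addHalf : ∀ {es w} τ → w ≢ v → Split es → Split (half (w , τ) ∷ es)
  addHalf τ w≢v S = record
    { Split S
    ; halves    = (_ , τ) ∷ halves S
    ; halves≢   = w≢v ∷ halves≢ S
    ; reduction = under _ (reduction S)
             then permute (↭-sym (shift _ (oddLoops (odd S)) _))
    }

  split : ∀ es → Split es
  split [] = record
    { odd = false ; halves = [] ; rest = [] ; halves≢ = [] ; rest-degree = refl
    ; reduction = permute refl }
  split (link a b τ ∷ es) with a ≟ v | b ≟ v | split es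
  ... | yes refl | no b≢v | S = addHalf τ b≢v S
  ... | no a≢v | yes refl | S = record
    { Split (addHalf τ a≢v S)
    ; reduction = reverse then reduction (addHalf τ a≢v S) }
  ... | no a≢v | no b≢v | S = record
    { Split S
    ; rest        = link a b τ ∷ rest S
    ; rest-degree = cong₂ ℕ._+_ (cong₂ ℕ._+_ (δℕ-other a≢v) (δℕ-other b≢v)) (rest-degree S)
    ; reduction   = under _ (reduction S)
      then permute (↭-trans (↭-sym (shift _ (oddLoops (odd S)) _))
                            (++⁺ˡ (oddLoops (odd S)) (↭-sym (shift _ (map half (halves S)) _))))
    }
  split (link a b Sign.- ∷ es) | yes refl | yes refl | S =
    record { Split S ; reduction = cancel then reduction S }
  split (link a b Sign.+ ∷ es) | yes refl | yes refl | S@record { odd = false } =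
    record { Split S ; odd = true ; reduction = under _ (reduction S) }
  split (link a b Sign.+ ∷ es) | yes refl | yes refl | S@record { odd = true } =
    record { Split S ; odd = false
           ; reduction = under _ (reduction S) then merge then cancel }

  -- With an odd number of halves the last one stays unpaired; it is the only link end left at `v`.
  pair : List (Fin n × Sign) → List (Link n)
  pair []                            = []
  pair (h ∷ [])                      = [ half h ]
  pair ((a , σ) ∷ (b , τ) ∷ hs) = link a b (opposite (σ Sign.* τ)) ∷ pair hs

  pair-reduction : ∀ hs es → Reduction v (map half hs ++ es) (pair hs ++ es)
  pair-reduction []           es = permute refl
  pair-reduction (h ∷ [])     es = permute refl
  pair-reduction (h ∷ h′ ∷ hs) es = merge then under _ (pair-reduction hs es)

  pair-degree : ∀ {hs es} → All (λ h → proj₁ h ≢ v) hs → degree v es ≡ 0 →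
                degree v (pair hs ++ es) ℕ.≤ 1
  pair-degree []                es≡0 rewrite es≡0 = z≤n
  pair-degree (a≢v ∷ [])        es≡0 rewrite es≡0 | δℕ-same v | δℕ-other a≢v = s≤s z≤n
  pair-degree (a≢v ∷ b≢v ∷ hs≢) es≡0 rewrite δℕ-other a≢v | δℕ-other b≢v = pair-degree hs≢ es≡0

  Eliminable : List (Link n) → Set
  Eliminable es = ∃[ es′ ] Reduction v es es′ × degree v es′ ℕ.≤ 1

  -- A possible odd loop at `v` is absorbed by the given half, which keeps its other end `w` and
  -- changes its parity. The halves are then paired as usual.
  eliminate-half : ∀ {es w} τ → w ≢ v → Eliminable (half (w , τ) ∷ es)
  eliminate-half {es} τ w≢v with split es
  ... | S@record { odd = false } =
    _ , (under _ (reduction S) then pair-reduction (_ ∷ halves S) _)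
      , pair-degree (w≢v ∷ halves≢ S) (rest-degree S)
  ... | S@record { odd = true } =
    -- The loop is moved to the front because the merged link starts at the far end of the first
    -- link, which for the loop is `v` itself.
    _ , (under _ (reduction S) then permute (swap _ _ refl) then merge
         then pair-reduction (_ ∷ halves S) _)
      , pair-degree (w≢v ∷ halves≢ S) (rest-degree S)

  -- Any half at `v` absorbs an odd loop, so the second alternative arises only when the loop is all
  -- that is left at `v`.
  eliminate : ∀ es → Eliminable es ⊎
              (∃[ es′ ] Reduction v es (link v v Sign.+ ∷ es′) × degree v es′ ≡ 0)
  eliminate es with split es
  ... | S@record { odd = false } =
    inj₁ (_ , (reduction S then pair-reduction (halves S) _) , pair-degree (halves≢ S) (rest-degree S))
  ... | S@record { odd = true ; halves = [] } = inj₂ (_ , reduction S , rest-degree S)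
  ... | record { odd = true ; halves = _ ∷ hs ; rest = es′
               ; halves≢ = w≢v ∷ hs≢ ; rest-degree = d ; reduction = r } =
    inj₁ (_ , (r then merge then pair-reduction (_ ∷ hs) es′) , pair-degree {_ ∷ hs} (w≢v ∷ hs≢) d)

-- Counting, and signed trails with small sums at every vertex

length-⊆ : ∀ {A : Set} {xs ys : List A} → Unique xs → xs ⊆ ys → length xs ℕ.≤ length ys
length-⊆ []                _     = z≤n
length-⊆ {xs = x ∷ _} (x∉xs ∷ xs!) xs⊆ys with ∈-∃++ (xs⊆ys (here refl))
... | ps , qs , refl = ℕₚ.≤-trans (s≤s (length-⊆ xs! xs⊆ps++qs)) (ℕₚ.≤-reflexive (≡.sym (↭-length moved)))
  where
  moved : ps ++ x ∷ qs ↭ x ∷ ps ++ qs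
  moved = shift x ps qs
  xs⊆ps++qs : _ ⊆ ps ++ qs
  xs⊆ps++qs y∈xs with ∈-resp-↭ moved (xs⊆ys (there y∈xs))
  ... | here refl = contradiction refl (All.lookup x∉xs y∈xs)
  ... | there y∈  = y∈

sum-· : ∀ s (f : Fin n → ℤ) → sum (λ i → s · f i) ≡ s · sum f
sum-· Sign.+ f = refl
sum-· {zero}  Sign.- f = refl
sum-· {suc n} Sign.- f = ≡.trans (cong (ℤ._+_ (- f zero)) (sum-· Sign.- (f ∘ suc)))
  (≡.sym (ℤₚ.neg-distrib-+ (f zero) _))

sum-effect : (e : Link n) → sum (effect e) ≡ 1ℤ ℤ.+ Link.parity e · 1ℤ
sum-effect (link a b τ) = ≡.trans (∑-distrib-+ (δ a) (λ v → τ · δ b v))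
  (cong₂ ℤ._+_ (sum-δ a) (≡.trans (sum-· τ (δ b)) (cong (τ ·_) (sum-δ b))))

sum-add : ∀ s (e : Link n) (x : Fin n → ℤ) →
          sum (λ v → s · effect e v ℤ.+ x v) ≡ s · (1ℤ ℤ.+ Link.parity e · 1ℤ) ℤ.+ sum x
sum-add s e x = ≡.trans (∑-distrib-+ (λ v → s · effect e v) x)
  (cong (ℤ._+ sum x) (≡.trans (sum-· s (effect e)) (cong (s ·_) (sum-effect e))))

-- Here `r` is the number of roots yet to be treated. Each may leave one odd loop, which costs 2 in
-- the total; hence the allowance `r + r`.
record Bounded (es : List (Link n)) (r : ℕ) : Set where
  constructor bounded
  field
    sums    : Fin n → ℤ
    attains : Attains es sums
    sums≤1  : ∀ v → sums v ℤ.≤ 1ℤ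
    total   : 0ℤ ℤ.≤ sum sums ℤ.+ + (r ℕ.+ r)

-- Every link gets the sign `+`. It then adds 2 or 0 to the total, and to each vertex at most the
-- number of its ends there.
attains-degree : (es : List (Link n)) →
                 ∃[ x ] Attains es x × (∀ v → x v ℤ.≤ + degree v es) × 0ℤ ℤ.≤ sum x
attains-degree {n} [] = (λ _ → 0ℤ) , [] (λ _ → refl) , (λ _ → ℤₚ.≤-refl) , ℤₚ.≤-reflexive (≡.sym (sum-zero n))
attains-degree (link a b τ ∷ es) with attains-degree es
... | x , att , x≤ , 0≤ =
  _ , add Sign.+ att (λ _ → refl)
    , (λ v → ℤₚ.+-mono-≤ (ℤₚ.+-monoʳ-≤ (δ a v) (·≤ τ (δℕ b v))) (x≤ v))
    , subst (0ℤ ℤ.≤_) (≡.sym (sum-add Sign.+ (link a b τ) x)) (ℤₚ.+-mono-≤ (0≤1+ τ) 0≤)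
  where
  ·≤ : ∀ τ k → τ · + k ℤ.≤ + k
  ·≤ Sign.+ k = ℤₚ.≤-refl
  ·≤ Sign.- k = ℤₚ.neg-≤-pos {k}
  0≤1+ : ∀ τ → 0ℤ ℤ.≤ 1ℤ ℤ.+ τ · 1ℤ
  0≤1+ Sign.+ = ℤ.+≤+ z≤n
  0≤1+ Sign.- = ℤ.+≤+ z≤n

bounded-reduction : ∀ {v : Fin n} {es es′ r} → Reduction v es es′ → Bounded es′ r → Bounded es r
bounded-reduction red (bounded x att x≤1 0≤) = bounded x (attains-reduction red att) x≤1 0≤

bounded-suc : ∀ {es : List (Link n)} {r} → Bounded es r → Bounded es (suc r)
bounded-suc {r = r} (bounded x att x≤1 0≤) = bounded x att x≤1 (ℤₚ.≤-trans 0≤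
  (ℤₚ.+-monoʳ-≤ (sum x) (ℤ.+≤+ (ℕₚ.+-mono-≤ (ℕₚ.n≤1+n r) (ℕₚ.n≤1+n r)))))

-- The loop is signed `-`. This only lowers the sum at `v`, and the loss of 2 in the total is paid
-- by the step from `r` to `suc r`.
bounded-loop : ∀ {v : Fin n} {es r} → Bounded es r → Bounded (link v v Sign.+ ∷ es) (suc r)
bounded-loop {v = v} {r = r} (bounded x att x≤1 0≤) =
  bounded _ (add Sign.- att (λ _ → refl))
    (λ u → ℤₚ.≤-trans (ℤₚ.+-monoˡ-≤ (x u) (ℤₚ.neg-≤-pos {δℕ v u ℕ.+ δℕ v u} {0}))
                         (ℤₚ.≤-trans (ℤₚ.≤-reflexive (ℤₚ.+-identityˡ (x u))) (x≤1 u)))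
    (subst (0ℤ ℤ.≤_) (≡.sym balance) 0≤)
  where
  open ≡-Reasoning
  identity : ∀ s r → - (1ℤ ℤ.+ 1ℤ) ℤ.+ s ℤ.+ ((1ℤ ℤ.+ r) ℤ.+ (1ℤ ℤ.+ r)) ≡ s ℤ.+ (r ℤ.+ r)
  identity = solve-∀
  balance : sum (λ u → - (δ v u ℤ.+ δ v u) ℤ.+ x u) ℤ.+ + (suc r ℕ.+ suc r) ≡ sum x ℤ.+ + (r ℕ.+ r)
  balance = ≡.trans (cong (ℤ._+ + (suc r ℕ.+ suc r)) (sum-add Sign.- (link v v Sign.+) x))
                    (identity (sum x) (+ r))

Joined : List (Link n) → Fin n → Fin n → Set
Joined es u w = ∃[ τ ] (link u w τ ∈ es ⊎ link w u τ ∈ es)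

joined-reduction : ∀ {v u w : Fin n} {es es′} → u ≢ v → w ≢ v → Reduction v es es′ →
                   Joined es u w → Joined es′ u w
joined-reduction u≢v w≢v red (τ , inj₁ e∈) = τ , inj₁ (∈-reduction u≢v w≢v red e∈)
joined-reduction u≢v w≢v red (τ , inj₂ e∈) = τ , inj₂ (∈-reduction w≢v u≢v red e∈)

extract : ∀ {A : Set} {x : A} {xs} → x ∈ xs → ∃[ ys ] xs ↭ x ∷ ys
extract {x = x} x∈ with ∈-∃++ x∈
... | ps , qs , refl = _ , shift x ps qs

-- The link between `v` and `w`, reversed if necessary, serves as the half that absorbs an odd loop.
eliminate-joined : ∀ {v w : Fin n} {es} → w ≢ v → Joined es v w → Eliminable v es
eliminate-joined {v = v} w≢v (τ , inj₁ e∈) with extract e∈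
... | es′ , q with eliminate-half v {es′} τ w≢v
...   | es″ , red , deg = es″ , (permute q then red) , deg
eliminate-joined {v = v} w≢v (τ , inj₂ e∈) with extract e∈
... | es′ , q with eliminate-half v {es′} τ w≢v
...   | es″ , red , deg = es″ , (permute q then reverse then red) , deg

∈∧∉⇒≢ : ∀ {A : Set} {u v : A} {vs} → u ∈ vs → v ∉ vs → u ≢ v
∈∧∉⇒≢ u∈ v∉ refl = v∉ u∈

degree-outside : ∀ {v : Fin n} {vs es es′} → Reduction v es es′ → degree v es′ ℕ.≤ 1 →
                 (∀ u → u ∉ v ∷ vs → degree u es ℕ.≤ 1) → ∀ u → u ∉ vs → degree u es′ ℕ.≤ 1
degree-outside {v = v} red deg outside u u∉ with u ≟ v
... | yes refl = deg
... | no u≢v   = ℕₚ.≤-trans (degree-reduction u red)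
  (outside u λ { (here u≡v) → u≢v u≡v ; (there u∈) → u∉ u∈ })

-- Vertex orders grown from one root per component

module _ {n : ℕ} (G : Graph n) where
  open Graph G
  open DecMembership (_≟_ {n}) using (_∈?_)

  -- A vertex order read from right to left: each new vertex is adjacent to an
  -- earlier one or, as a root, unconnected to the earlier roots.
  data Order : List (Fin n) → List (Fin n) → Set where
    []   : Order [] []
    grow : ∀ {v w vs rs} → v ∉ vs → w ∈ vs → Adj v w → Order vs rs → Order (v ∷ vs) rs
    root : ∀ {v vs rs} → v ∉ vs → All (λ r → ¬ Connected G r v) rs →
           Order vs rs → Order (v ∷ vs) (v ∷ rs)

  roots⊆ : ∀ {vs rs} → Order vs rs → rs ⊆ vs
  roots⊆ (grow _ _ _ o) r∈           = there (roots⊆ o r∈)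
  roots⊆ (root _ _ o)   (here refl)  = here refl
  roots⊆ (root _ _ o)   (there r∈)   = there (roots⊆ o r∈)

  -- Follow the walk and append each vertex not yet present; its predecessor on the walk is the
  -- required neighbour.
  grow-along : ∀ {vs rs w u} → Order vs rs → w ∈ vs → Connected G w u →
               ∃[ vs′ ] Order vs′ rs × vs ⊆ vs′ × u ∈ vs′
  grow-along o w∈ ε = _ , o , id , w∈
  grow-along {vs} o w∈ (_◅_ {j = x} wx p) with x ∈? vs
  ... | yes x∈ = grow-along o x∈ p
  ... | no x∉ with grow-along (grow x∉ w∈ (adjSym wx) o) (here refl) p
  ...   | _ , o′ , ⊆ , u∈ = _ , o′ , ⊆ ∘ there , u∈

  extend : ∀ {vs rs} → Order vs rs → ∀ u → ∃[ vs′ ] ∃[ rs′ ] Order vs′ rs′ × vs ⊆ vs′ × u ∈ vs′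
  extend {vs} {rs} o u with u ∈? vs | Any.any? (λ r → connected? G r u) rs
  ... | yes u∈ | _ = _ , _ , o , id , u∈
  ... | no u∉ | no ¬any = _ , _ , root u∉ (Allₚ.¬Any⇒All¬ rs ¬any) o , there , here refl
  ... | no u∉ | yes any with find any
  ...   | r , r∈ , ru with grow-along o (roots⊆ o r∈) ru
  ...     | _ , o′ , ⊆ , u∈ = _ , _ , o′ , ⊆ , u∈

  spanning-order : ∃[ vs ] ∃[ rs ] Order vs rs × (∀ v → v ∈ vs)
  spanning-order with go (allFin n)
    where
    go : ∀ us → ∃[ vs ] ∃[ rs ] Order vs rs × us ⊆ vs
    go []       = _ , _ , [] , λ ()
    go (u ∷ us) with go us
    ... | _ , _ , o , us⊆ with extend o u
    ...   | _ , _ , o′ , ⊆ , u∈ = _ , _ , o′ , λ { (here refl) → u∈ ; (there v∈) → ⊆ (us⊆ v∈) }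
  ... | vs , rs , o , all⊆ = vs , rs , o , λ v → all⊆ (∈-allFin v)

  -- The head of the order is treated first. In a `grow` step it is linked to a vertex still to
  -- come, so `eliminate-joined` applies; at a root an odd loop may survive, and the entry of the
  -- root in `rs` pays for it. The two hypotheses on `es` are the invariants: adjacent untreated
  -- vertices are still linked directly, and treated vertices carry at most one link end. Once all
  -- are treated, `attains-degree` finishes.
  bounded-order : ∀ {vs rs es} → Order vs rs →
                  (∀ {u w} → u ∈ vs → w ∈ vs → Adj u w → Joined es u w) →
                  (∀ u → u ∉ vs → degree u es ℕ.≤ 1) → Bounded es (length rs)
  bounded-order {es = es} [] joined outside with attains-degree es
  ... | x , att , x≤ , 0≤ = bounded x att
    (λ v → ℤₚ.≤-trans (x≤ v) (ℤ.+≤+ (outside v λ ())))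
    (ℤₚ.≤-trans 0≤ (ℤₚ.≤-reflexive (≡.sym (ℤₚ.+-identityʳ (sum x)))))
  bounded-order (grow v∉ w∈ vw o) joined outside
    with eliminate-joined (∈∧∉⇒≢ w∈ v∉) (joined (here refl) (there w∈) vw)
  ... | es′ , red , deg = bounded-reduction red
    (bounded-order o
      (λ u∈ w∈ uw → joined-reduction (∈∧∉⇒≢ u∈ v∉) (∈∧∉⇒≢ w∈ v∉) red (joined (there u∈) (there w∈) uw))
      (degree-outside red deg outside))
  bounded-order {es = es} (root {v} v∉ _ o) joined outside with eliminate v es
  ... | inj₁ (es′ , red , deg) = bounded-suc (bounded-reduction red
    (bounded-order o
      (λ u∈ w∈ uw → joined-reduction (∈∧∉⇒≢ u∈ v∉) (∈∧∉⇒≢ w∈ v∉) red (joined (there u∈) (there w∈) uw))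
      (degree-outside red deg outside)))
  ... | inj₂ (es′ , red , deg) = bounded-reduction red (bounded-loop
    (bounded-order o
      (λ u∈ w∈ uw → drop-loop (∈∧∉⇒≢ u∈ v∉)
        (joined-reduction (∈∧∉⇒≢ u∈ v∉) (∈∧∉⇒≢ w∈ v∉) red (joined (there u∈) (there w∈) uw)))
      outside′))
    where
    drop-loop : ∀ {u w} → u ≢ v → Joined (link v v Sign.+ ∷ es′) u w → Joined es′ u w
    drop-loop u≢v (τ , inj₁ (here refl)) = contradiction refl u≢v
    drop-loop u≢v (τ , inj₁ (there e∈))  = τ , inj₁ e∈
    drop-loop u≢v (τ , inj₂ (here refl)) = contradiction refl u≢v
    drop-loop u≢v (τ , inj₂ (there e∈))  = τ , inj₂ e∈
    outside′ : ∀ u → u ∉ _ → degree u es′ ℕ.≤ 1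
    outside′ u u∉ with u ≟ v
    ... | yes refl = ℕₚ.≤-trans (ℕₚ.≤-reflexive deg) z≤n
    ... | no u≢v   = ℕₚ.≤-trans (ℕₚ.m≤n+m _ _) (ℕₚ.≤-trans (degree-reduction u red)
      (outside u λ { (here u≡v) → u≢v u≡v ; (there u∈) → u∉ u∈ }))

  -- Components and the size of a spanning forest

  component≡⇒connected : ∀ {u v} → component G u ≡ component G v → Connected G u v
  component≡⇒connected {u} {v} eq with connected? G u v in uv
  ... | yes p = p
  -- The two indicator vectors are compared at `v`, which lies in its own component.
  ... | no ¬p = contradiction false≡true λ ()
    where
    open ≡-Reasoning
    false≡true : false ≡ true
    false≡true = begin
      false                            ≡⟨ cong does uv ⟨
      does (connected? G u v)          ≡⟨ lookup∘tabulate (λ w → does (connected? G u w)) v ⟨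
      Vec.lookup (component G u) v     ≡⟨ cong (λ c → Vec.lookup c v) eq ⟩
      Vec.lookup (component G v) v     ≡⟨ lookup∘tabulate (λ w → does (connected? G v w)) v ⟩
      does (connected? G v v)          ≡⟨ dec-true (connected? G v v) ε ⟩
      true                             ∎

  component∈ : ∀ v → component G v ∈ components G
  component∈ v = ∈-deduplicate⁺ _ (∈-map⁺ (component G) (∈-allFin v))

  -- Roots are pairwise unconnected, so their components are distinct entries of `components G`.
  roots≤ω : ∀ {vs rs} → Order vs rs → length rs ℕ.≤ ω G
  roots≤ω {rs = rs} o = subst (ℕ._≤ ω G) (length-map (component G) rs)
    (length-⊆ (distinct o) ⊆components)
    where
    distinct : ∀ {vs rs} → Order vs rs → Unique (map (component G) rs)
    distinct []              = []
    distinct (grow _ _ _ o)  = distinct o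
    distinct (root _ ¬con o) =
      Allₚ.map⁺ (All.map (λ ¬rv eq → ¬rv (component≡⇒connected (≡.sym eq))) ¬con) ∷ distinct o
    ⊆components : map (component G) rs ⊆ components G
    ⊆components c∈ with ∈-map⁻ (component G) c∈
    ... | v , _ , refl = component∈ v

  edge-between : ∀ {u v} → Adj u v →
                 ∃[ e ] Incident G u e × (∀ {x} → Incident G x e → x ≡ u ⊎ x ≡ v)
  edge-between {u} {v} uv with <-cmp u v
  ... | tri< u<v _ _ = mkEdge u v u<v uv , inj₁ refl
    , λ { (inj₁ refl) → inj₁ refl ; (inj₂ refl) → inj₂ refl }
  ... | tri≈ _ u≡v _ = contradiction uv (adjIrr u≡v)
  ... | tri> _ _ v<u = mkEdge v u v<u (adjSym uv) , inj₂ refl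
    , λ { (inj₁ refl) → inj₂ refl ; (inj₂ refl) → inj₁ refl }

  -- Every vertex that is not a root brings an edge to a neighbour already present. These edges form
  -- a spanning forest.
  n≤edges+ω : n ℕ.≤ length (edges G) ℕ.+ ω G
  n≤edges+ω with spanning-order
  ... | vs , rs , o , ∈vs with forest o
    where
    forest : ∀ {vs rs} → Order vs rs →
             ∃[ L ] Unique L × length vs ℕ.≤ length L ℕ.+ length rs ×
                    (∀ {e v} → e ∈ L → Incident G v e → v ∈ vs)
    forest []             = [] , [] , z≤n , λ ()
    forest (root {rs = rs} _ _ o) with forest o
    ... | L , L! , len , in-vs =
      L , L! , ℕₚ.≤-trans (s≤s len) (ℕₚ.≤-reflexive (≡.sym (ℕₚ.+-suc (length L) (length rs))))
        , λ e∈ inc → there (in-vs e∈ inc)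
    forest (grow {v} {w} {vs} v∉ w∈ vw o) with forest o | edge-between vw
    ... | L , L! , len , in-vs | e , v∈e , ends =
      -- The edge `e` is new because it meets `v`, whereas the edges collected so far have both ends
      -- in `vs`.
      e ∷ L , All.tabulate (λ { e∈ refl → v∉ (in-vs e∈ v∈e) }) ∷ L! , s≤s len , in-vs′
      where
      in-vs′ : ∀ {e′ u} → e′ ∈ e ∷ L → Incident G u e′ → u ∈ v ∷ vs
      in-vs′ (there e∈)  inc = there (in-vs e∈ inc)
      in-vs′ (here refl) inc with ends inc
      ... | inj₁ refl = here refl
      ... | inj₂ refl = there w∈
  ...   | L , L! , len , _ = begin
    n                                  ≡⟨ length-tabulate id ⟨
    length (allFin n)                  ≤⟨ length-⊆ (allFin⁺ n) (λ {v} _ → ∈vs v) ⟩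
    length vs                          ≤⟨ len ⟩
    length L ℕ.+ length rs             ≤⟨ ℕₚ.+-mono-≤ (length-⊆ L! (λ {e} _ → ∈-edges G e)) (roots≤ω o) ⟩
    length (edges G) ℕ.+ ω G           ∎
    where open ℕₚ.≤-Reasoning

-- Edges as trails and signings of the graph

0≤i+i⇒0≤i : ∀ {i} → 0ℤ ℤ.≤ i ℤ.+ i → 0ℤ ℤ.≤ i
0≤i+i⇒0≤i {+ _} _ = ℤ.+≤+ z≤n

double-+ : ∀ i j → (i ℤ.+ i) ℤ.+ (j ℤ.+ j) ≡ (i ℤ.+ j) ℤ.+ (i ℤ.+ j)
double-+ = solve-∀

module _ {n : ℕ} (G : Graph n) where
  open Graph G
  open DecMembership (_≟_ {n}) using (_∈?_)

  -- A single edge is a trail of length one, hence of odd parity `+`.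
  toLink : Edge G → Link n
  toLink e = link (src e) (tgt e) Sign.+

  src≢tgt : (e : Edge G) → src e ≢ tgt e
  src≢tgt (mkEdge u v u<v _) u≡v = ⊥-elim-irr (Finₚ.<⇒≢ u<v u≡v)

  value-· : ∀ s → value G s ≡ s · 1ℤ
  value-· Sign.+ = refl
  value-· Sign.- = refl

  -- For `L = edges G` this is the sum bounded in `Good`; a general `L` allows induction on the list
  -- of edges.
  sumAt : Signing G → Fin n → List (Edge G) → ℤ
  sumAt f v L = sumOver G f (filter (incident? G v) L)

  sumAt-∷ : ∀ f v e L → sumAt f v (e ∷ L) ≡ f e · effect (toLink e) v ℤ.+ sumAt f v L
  sumAt-∷ f v e L with src e ≟ v | tgt e ≟ v
  ... | yes p | yes q = contradiction (≡.trans p (≡.sym q)) (src≢tgt e)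
  ... | yes p | no _  = cong (ℤ._+ sumAt f v L) (value-· (f e))
  ... | no _  | yes q = cong (ℤ._+ sumAt f v L) (value-· (f e))
  ... | no ¬p | no ¬q = ≡.sym (≡.trans (cong (ℤ._+ sumAt f v L) (·-0 (f e))) (ℤₚ.+-identityˡ _))
    where
    ·-0 : ∀ s → s · 0ℤ ≡ 0ℤ
    ·-0 Sign.+ = refl
    ·-0 Sign.- = refl

  handshake : ∀ f L → sum (λ v → sumAt f v L) ≡ sumOver G f L ℤ.+ sumOver G f L
  handshake f []      = sum-zero n
  handshake f (e ∷ L) = begin
    sum (λ v → sumAt f v (e ∷ L))                                     ≡⟨ sum-cong-≗ (λ v → sumAt-∷ f v e L) ⟩
    sum (λ v → f e · effect (toLink e) v ℤ.+ sumAt f v L)             ≡⟨ sum-add (f e) (toLink e) (λ v → sumAt f v L) ⟩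
    f e · (1ℤ ℤ.+ 1ℤ) ℤ.+ sum (λ v → sumAt f v L)                     ≡⟨ cong₂ ℤ._+_ (double (f e)) (handshake f L) ⟩
    (value G (f e) ℤ.+ value G (f e)) ℤ.+ (sumOver G f L ℤ.+ sumOver G f L)
      ≡⟨ double-+ (value G (f e)) (sumOver G f L) ⟩
    sumOver G f (e ∷ L) ℤ.+ sumOver G f (e ∷ L)                       ∎
    where
    open ≡-Reasoning
    double : ∀ s → s · (1ℤ ℤ.+ 1ℤ) ≡ value G s ℤ.+ value G s
    double Sign.+ = refl
    double Sign.- = refl

  assign : Edge G → Sign → Signing G → Signing G
  assign e s f e′ with _≟ᴱ_ G e e′
  ... | yes _ = s
  ... | no  _ = f e′

  assign-same : ∀ e s f → assign e s f e ≡ s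
  assign-same e s f with _≟ᴱ_ G e e
  ... | yes _  = refl
  ... | no e≢e = contradiction refl e≢e

  sumOver-assign-∉ : ∀ {e} s f {L} → All (e ≢_) L → sumOver G (assign e s f) L ≡ sumOver G f L
  sumOver-assign-∉ s f [] = refl
  sumOver-assign-∉ {e} s f {e′ ∷ _} (e≢e′ ∷ e∉) with _≟ᴱ_ G e e′
  ... | yes e≡e′ = contradiction e≡e′ e≢e′
  ... | no _     = cong (ℤ._+_ (value G (f e′))) (sumOver-assign-∉ s f e∉)

  sumOver-flip : ∀ {e} f {L} → Unique L → e ∈ L → f e ≡ Sign.- →
                 sumOver G (assign e Sign.+ f) L ≡ + 2 ℤ.+ sumOver G f L
  sumOver-flip f {e ∷ L} (e∉ ∷ _) (here refl) fe
    rewrite assign-same e Sign.+ f | sumOver-assign-∉ Sign.+ f e∉ | fe = identity (sumOver G f L)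
    where
    identity : ∀ a → 1ℤ ℤ.+ a ≡ + 2 ℤ.+ (-1ℤ ℤ.+ a)
    identity = solve-∀
  sumOver-flip {e} f {e′ ∷ L} (e′∉ ∷ L!) (there e∈) fe with _≟ᴱ_ G e e′
  ... | yes refl = contradiction refl (All.lookup e′∉ e∈)
  ... | no _     = ≡.trans (cong (ℤ._+_ (value G (f e′))) (sumOver-flip f L! e∈ fe))
                           (identity (value G (f e′)) (sumOver G f L))
    where
    identity : ∀ a b → a ℤ.+ (+ 2 ℤ.+ b) ≡ + 2 ℤ.+ (a ℤ.+ b)
    identity = solve-∀

  -- The sign of each link becomes the sign of its edge. Uniqueness ensures that assigning a sign to
  -- the head leaves the sums over the tail unchanged.
  attains⇒signing : ∀ {L x} → Unique L → Attains (map toLink L) x →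
                    ∃[ f ] (∀ v → sumAt f v L ≡ x v)
  attains⇒signing {[]} [] ([] x≡0) = allMinus G , ≡.sym ∘ x≡0
  attains⇒signing {e ∷ L} {x} (e∉ ∷ L!) (add {y = y} s att x≡) with attains⇒signing L! att
  ... | f , f≡ = g , λ v → begin
    sumAt g v (e ∷ L)                              ≡⟨ sumAt-∷ g v e L ⟩
    g e · effect (toLink e) v ℤ.+ sumAt g v L      ≡⟨ cong₂ (λ t i → t · effect (toLink e) v ℤ.+ i)
                                                             (assign-same e s f)
                                                             (sumOver-assign-∉ s f (Allₚ.filter⁺ (incident? G v) e∉)) ⟩
    s · effect (toLink e) v ℤ.+ sumAt f v L        ≡⟨ cong (ℤ._+_ (s · effect (toLink e) v)) (f≡ v) ⟩
    s · effect (toLink e) v ℤ.+ y v                ≡⟨ x≡ v ⟨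
    x v                                            ∎
    where
    open ≡-Reasoning
    g = assign e s f

  -- Raising edges and the induction on d

  sumOver-plus : ∀ f {L} → All (λ e → f e ≢ Sign.-) L → sumOver G f L ≡ + length L
  sumOver-plus f [] = refl
  sumOver-plus f {e ∷ L} (fe≢- ∷ plus) with f e
  ... | Sign.+ = cong (ℤ._+_ 1ℤ) (sumOver-plus f plus)
  ... | Sign.- = contradiction refl fe≢-

  minusEdge : ∀ f L → (∃[ e ] e ∈ L × f e ≡ Sign.-) ⊎ sumOver G f L ≡ + length L
  minusEdge f L with Any.any? (λ e → f e Signₚ.≟ Sign.-) L
  ... | yes any = inj₁ (find any)
  ... | no ¬any = inj₂ (sumOver-plus f (Allₚ.¬Any⇒All¬ L ¬any))

  -- The list `bad` may overestimate the vertices with sum above 1; only its length is controlled.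
  -- The bound d - ω on the weight is written without subtraction.
  record Admissible (d : ℕ) : Set where
    field
      signing : Signing G
      bad     : List (Fin n)
      bad≤    : length bad ℕ.≤ d
      good    : ∀ v → v ∉ bad → Good G signing v
      weight≥ : + d ℤ.≤ weight G signing ℤ.+ + ω G

  open Admissible

  joined-edges : ∀ {u v} → Adj u v → Joined (map toLink (edges G)) u v
  joined-edges {u} {v} uv with <-cmp u v
  ... | tri< u<v _ _ = Sign.+ , inj₁ (∈-map⁺ toLink (∈-edges G (mkEdge u v u<v uv)))
  ... | tri≈ _ u≡v _ = contradiction uv (adjIrr u≡v)
  ... | tri> _ _ v<u = Sign.+ , inj₂ (∈-map⁺ toLink (∈-edges G (mkEdge v u v<u (adjSym uv))))

  -- By the handshake identity the vertex sums add up to twice the weight. So a total of at least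
  -- -2r, for r roots, gives weight at least -r, and r is at most ω.
  admissible-0 : Admissible 0
  admissible-0 with spanning-order G
  ... | vs , rs , o , ∈vs
    with bounded-order G {es = map toLink (edges G)} o (λ _ _ → joined-edges)
           (λ u u∉ → contradiction (∈vs u) u∉)
  ... | bounded x att x≤1 0≤ with attains⇒signing (edges-unique G) att
  ... | f , f≡ = record
    { signing = f ; bad = [] ; bad≤ = z≤n
    ; good    = λ v _ → ℤₚ.≤-trans (ℤₚ.≤-reflexive (f≡ v)) (x≤1 v)
    ; weight≥ = ℤₚ.≤-trans
        (0≤i+i⇒0≤i (ℤₚ.≤-trans 0≤ (ℤₚ.≤-reflexive double)))
        (ℤₚ.+-monoʳ-≤ (weight G f) (ℤ.+≤+ (roots≤ω G o)))
    }
    where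
    open ≡-Reasoning
    r = + length rs
    double : sum x ℤ.+ (r ℤ.+ r) ≡ (weight G f ℤ.+ r) ℤ.+ (weight G f ℤ.+ r)
    double = begin
      sum x ℤ.+ (r ℤ.+ r)                               ≡⟨ cong (ℤ._+ (r ℤ.+ r)) (sum-cong-≗ f≡) ⟨
      sum (λ v → sumAt f v (edges G)) ℤ.+ (r ℤ.+ r)     ≡⟨ cong (ℤ._+ (r ℤ.+ r)) (handshake f (edges G)) ⟩
      weight G f ℤ.+ weight G f ℤ.+ (r ℤ.+ r)           ≡⟨ double-+ (weight G f) r ⟩
      (weight G f ℤ.+ r) ℤ.+ (weight G f ℤ.+ r)         ∎

  flip-elsewhere : ∀ {e v} f → ¬ Incident G v e → Good G f v → Good G (assign e Sign.+ f) v
  flip-elsewhere {e} {v} f ¬inc = subst (ℤ._≤ 1ℤ) (≡.sym (sumOver-assign-∉ Sign.+ f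
    (All.tabulate λ { e′∈ refl → ¬inc (proj₂ (∈-filter⁻ (incident? G v) {xs = edges G} e′∈)) })))

  flip-weight : ∀ {e} f → f e ≡ Sign.- → weight G (assign e Sign.+ f) ≡ + 2 ℤ.+ weight G f
  flip-weight f = sumOver-flip f (edges-unique G) (∈-edges G _)

  flip-weight≥ : ∀ {e d} f → f e ≡ Sign.- → + d ℤ.≤ weight G f ℤ.+ + ω G →
                 + (2 ℕ.+ d) ℤ.≤ weight G (assign e Sign.+ f) ℤ.+ + ω G
  flip-weight≥ f fe d≤ rewrite flip-weight f fe =
    ℤₚ.≤-trans (ℤₚ.+-monoʳ-≤ (+ 2) d≤)
      (ℤₚ.≤-reflexive (≡.sym (ℤₚ.+-assoc (+ 2) (weight G f) (+ ω G))))

  -- If no vertex sum were negative, neither would be their total, which is twice the weight.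
  deficient : ∀ f → weight G f ℤ.< 0ℤ → ∃[ v ] sumOver G f (edgesAt G v) ℤ.< 0ℤ
  deficient f w<0 with Finₚ.any? (λ v → sumOver G f (edgesAt G v) ℤₚ.<? 0ℤ)
  ... | yes v<0 = v<0
  ... | no ¬v<0 = contradiction w<0 (ℤₚ.≤⇒≯ (0≤i+i⇒0≤i (subst (0ℤ ℤ.≤_) (handshake f (edges G))
    (sum-nonneg (λ v → sumAt f v (edges G)) λ v → ℤₚ.≮⇒≥ λ v<0 → ¬v<0 (v , v<0)))))

  otherEnd : ∀ {v e} → Incident G v e → ∃[ u ] (∀ {w} → Incident G w e → w ≡ v ⊎ w ≡ u)
  otherEnd {e = e} (inj₁ refl) = tgt e , λ { (inj₁ refl) → inj₁ refl ; (inj₂ refl) → inj₂ refl }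
  otherEnd {e = e} (inj₂ refl) = src e , λ { (inj₁ refl) → inj₂ refl ; (inj₂ refl) → inj₁ refl }

  -- If the bound for d = 0 is attained with equality, then f is negative in
  -- total, hence at some vertex v; raising an edge at v can spoil only its
  -- other end.
  admissible-1 : 1 ℕ.≤ n → Admissible 1
  admissible-1 1≤n with 1ℤ ℤₚ.≤? weight G (signing admissible-0) ℤ.+ + ω G
  ... | yes 1≤ = record { Admissible admissible-0 ; bad≤ = z≤n ; weight≥ = 1≤ }
  ... | no 1≰ = raise (deficient f w<0)
    where
    f = signing admissible-0
    w<0 : weight G f ℤ.< 0ℤ
    -- There is a vertex and hence a component, so a nonnegative weight would make weight plus ω at
    -- least 1.
    w<0 = ℤₚ.≰⇒> λ 0≤w → 1≰ (ℤₚ.+-mono-≤ 0≤w (ℤ.+≤+ (∈-length (component∈ G (Fin.fromℕ< 1≤n)))))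
    raise : ∃[ v ] sumOver G f (edgesAt G v) ℤ.< 0ℤ → Admissible 1
    raise (v , v<0) with minusEdge f (edgesAt G v)
    ... | inj₂ eq = contradiction v<0 (ℤₚ.≤⇒≯ (subst (0ℤ ℤ.≤_) (≡.sym eq) (ℤ.+≤+ z≤n)))
    ... | inj₁ (e , e∈ , fe) with otherEnd {e = e} (proj₂ (∈-filter⁻ (incident? G v) {xs = edges G} e∈))
    ...   | u , ends = record
      { signing = assign e Sign.+ f
      ; bad     = [ u ]
      ; bad≤    = s≤s z≤n
      ; good    = good′
      ; weight≥ = ℤₚ.≤-trans (ℤ.+≤+ (s≤s z≤n)) (flip-weight≥ f fe (weight≥ admissible-0))
      }
      where
      good′ : ∀ w → w ∉ [ u ] → Good G (assign e Sign.+ f) w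
      good′ w w∉ with w ≟ v
      ... | yes refl = subst (ℤ._≤ 1ℤ)
        (≡.sym (sumOver-flip f (filter⁺ (incident? G v) (edges-unique G)) e∈ fe))
        -- The sum at `v` was at most -1, so raising one edge there leaves it at most 1.
        (ℤₚ.+-monoʳ-≤ (+ 2) (ℤₚ.i<j⇒i≤pred[j] v<0))
      ... | no w≢v = flip-elsewhere {e} f ¬inc (good admissible-0 w λ ())
        where
        ¬inc : ¬ Incident G w e
        ¬inc inc with ends inc
        ... | inj₁ w≡v = w≢v w≡v
        ... | inj₂ w≡u = w∉ (here w≡u)

  admissible-2+ : ∀ {d} → 2 ℕ.+ d ℕ.≤ n → Admissible d → Admissible (2 ℕ.+ d)
  admissible-2+ {d} 2+d≤n A with minusEdge (signing A) (edges G)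
  ... | inj₂ eq = record
    { Admissible A
    ; bad≤    = ℕₚ.m≤n⇒m≤o+n 2 (bad≤ A)
    ; weight≥ = subst (λ w → + (2 ℕ.+ d) ℤ.≤ w ℤ.+ + ω G) (≡.sym eq)
                  (ℤ.+≤+ (ℕₚ.≤-trans 2+d≤n (n≤edges+ω G)))
    }
  ... | inj₁ (e , _ , fe) = record
    { signing = assign e Sign.+ (signing A)
    ; bad     = src e ∷ tgt e ∷ bad A
    ; bad≤    = s≤s (s≤s (bad≤ A))
    ; good    = λ v v∉ → flip-elsewhere {e} (signing A)
        (λ { (inj₁ refl) → v∉ (here refl) ; (inj₂ refl) → v∉ (there (here refl)) })
        (good A v (v∉ ∘ there ∘ there))
    ; weight≥ = flip-weight≥ (signing A) fe (weight≥ A)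
    }

  admissible : 1 ℕ.≤ n → ∀ d → d ℕ.≤ n → Admissible d
  admissible 1≤n 0             _     = admissible-0
  admissible 1≤n 1             _     = admissible-1 1≤n
  admissible 1≤n (suc (suc d)) 2+d≤n =
    admissible-2+ 2+d≤n (admissible 1≤n d (ℕₚ.m+n≤o⇒n≤o 2 2+d≤n))

  -- Good vertices and `bad` together cover all k + d vertices, and `bad` accounts for at most d of
  -- them.
  admissible⇒submatching : ∀ {k d} → n ≡ k ℕ.+ d → (A : Admissible d) →
                           IsSignedSubmatching G k (signing A)
  admissible⇒submatching {k} {d} n≡k+d A = ℕₚ.+-cancelʳ-≤ d k _ (begin
    k ℕ.+ d                               ≡⟨ n≡k+d ⟨
    n                                     ≡⟨ length-tabulate id ⟨
    length (allFin n)                     ≤⟨ length-⊆ (allFin⁺ n) covered ⟩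
    length (goodVertices ++ bad A)        ≡⟨ length-++ goodVertices ⟩
    length goodVertices ℕ.+ length (bad A) ≤⟨ ℕₚ.+-monoʳ-≤ (length goodVertices) (bad≤ A) ⟩
    length goodVertices ℕ.+ d             ∎)
    where
    open ℕₚ.≤-Reasoning
    goodVertices = filter (good? G (signing A)) (allFin n)
    covered : ∀ {v} → v ∈ allFin n → v ∈ goodVertices ++ bad A
    covered {v} v∈ with v ∈? bad A
    ... | yes v∈bad = ∈-++⁺ʳ goodVertices v∈bad
    ... | no v∉bad  = ∈-++⁺ˡ (∈-filter⁺ (good? G (signing A)) v∈ (good A v v∉bad))

theorem2 : ∀ (n : ℕ) (G : Graph n) → NoIsolatedVertices G →
    ∀ (k : ℕ) → 1 ℕ.≤ k → k ℕ.≤ n →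
    βS G k ≥ + n - + k - + ω G
theorem2 n G _ k 1≤k k≤n with ℕₚ.m≤n⇒∃[o]m+o≡n k≤n
-- With n = k + d the claimed bound becomes d - ω, the one carried by `Admissible d`.
... | d , refl = ℤₚ.≤-trans (ℤₚ.≤-trans (ℤₚ.≤-reflexive (shorten (+ k) (+ d) (+ ω G)))
    (ℤₚ.≤-trans (ℤₚ.+-monoˡ-≤ (- + ω G) (weight≥ A)) (ℤₚ.≤-reflexive (cancelω (weight G (signing A)) (+ ω G)))))
  (βS-upper G {k} (signing A) (admissible⇒submatching G refl A))
  where
  open Admissible
  A = admissible G (ℕₚ.≤-trans 1≤k k≤n) d (ℕₚ.m≤n+m d k)
  shorten : ∀ k d w → k ℤ.+ d ℤ.- k ℤ.- w ≡ d ℤ.- w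
  shorten = solve-∀
  cancelω : ∀ i w → i ℤ.+ w ℤ.- w ≡ i
  cancelω = solve-∀
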